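{- Let $X$ be a normal modal logic and let $I$ be an index set with $\omega\subseteq I$. Suppose that $X$ is complete with respect to a set of Kripke frames $F=\{(G_\alpha,R_\alpha):\alpha\in I\}$, where for every $\alpha\in I$, $G_\alpha$ is a nonempty infinite set and $R_\alpha$ is an accessibility relation (a binary relation) on $G_\alpha$. Let $H=\{(G_i^*,R_i^*): i\in\omega\}$ be a set of Kripke frames such that for every $i\in\omega$: $$G_i^*=\{*,g_0,g_1,\dots,g_i\}\cup G_{\omega i},$$ where $G_{\omega i}=\{\eta_{ij}: j\in\omega\}$ has cardinality $\aleph_0$, $\{*,g_0,\dots,g_i\}\cap G_{\omega i}=\emptyset$, the elements $*,g_0,\dots,g_i$ are distinct, and $$R_i^*=\{(*,g_j):0\le j\le i\}\cup\{(g_j,g_k): 1\le j\le i,\ 1\le k\le i\}\cup\{(\eta,\eta):\eta\in G_{\omega i}\}.$$ If $H\subseteq F$, then $B$-translation is faithful with respect to $X$.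
   Context: The system $\mathbf{L_1}$ (Leśniewski's propositional ontology): fix a countably infinite set of name variables. The atomic formulas are exactly the expressions $\epsilon ab$ with $a,b$ name variables (possibly equal); formulas are built from atomic formulas by $\vee$ and $\neg$, the other connectives being the usual classical abbreviations. $\mathbf{L_1}$ is a Hilbert-style system of classical propositional logic (with modus ponens) over these formulas with the additional axiom schemata, for all name variables $a,b,c$: (Ax1) $\epsilon ab \supset \epsilon aa$; (Ax2) $(\epsilon ab \wedge \epsilon bc) \supset \epsilon ac$; (Ax3) $(\epsilon ab \wedge \epsilon bc) \supset \epsilon ba$. $B$-translation: to each name variable $a$ corresponds a propositional variable $p_a$, with distinct name variables corresponding to distinct propositional variables. $B$ maps formulas of $\mathbf{L_1}$ to propositional modal formulas by $B(\phi\vee\psi)=B(\phi)\vee B(\psi)$, $B(\neg\phi)=\neg B(\phi)$, $B(\epsilon ab)=p_a\wedge\Box(p_a\supset p_b)\wedge\bigl(p_b\supset\Box(p_b\supset p_a)\bigr)$. $B$-translation is faithful with respect to a modal logic $X$ if for every formula $\phi$ of $\mathbf{L_1}$, $\vdash_X B(\phi)$ implies $\vdash_{\mathbf{L_1}}\phi$. A normal modal logic is a set $X$ of propositional modal formulas with $\mathbf{K}\subseteq X$ that is closed under modus ponens, substitution and necessitation. $X$ is complete with respect to a set $F$ of Kripke frames if, for every modal formula $\chi$, $\vdash_X\chi$ holds if and only if $\chi$ is valid in every frame in $F$. -}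

module Defs where

open import Level using (Level; 0ℓ; _⊔_) renaming (suc to lsuc)
open import Data.Nat using (ℕ; suc; _≤_)
open import Data.Fin using (Fin; toℕ)
open import Data.Product using (∃; ∃₂; _×_)
open import Data.Sum using (_⊎_)
open import Function.Bundles using (_⇔_; _↔_; _↣_; module Injection)
open import Function.Definitions using (Injective)
open import Relation.Binary.Core using (Rel)
open import Relation.Binary.PropositionalEquality using (_≡_; _≢_)
open import Relation.Nullary using (¬_)
open import Relation.Unary using (Pred; _⊆_)

private
  variable
    ℓ ι : Level

-- In both languages only ∨ and ∼ (and □) are primitive; ⊃ and ∧ are the
-- usual abbreviations.  The axiom schemata, together with modus ponens,
-- axiomatise classical propositional logic.

module Classical {Form : Set} (_∨_ : Form → Form → Form) (∼_ : Form → Form) where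

  infixr 5 _⊃_
  infixr 6 _∧_

  _⊃_ : Form → Form → Form
  φ ⊃ ψ = (∼ φ) ∨ ψ

  _∧_ : Form → Form → Form
  φ ∧ ψ = ∼ ((∼ φ) ∨ (∼ ψ))

  data Axiom : Form → Set where
    weakening      : ∀ φ ψ → Axiom (φ ⊃ (ψ ⊃ φ))
    distribution   : ∀ φ ψ χ → Axiom ((φ ⊃ (ψ ⊃ χ)) ⊃ ((φ ⊃ ψ) ⊃ (φ ⊃ χ)))
    ∨-introˡ       : ∀ φ ψ → Axiom (φ ⊃ (φ ∨ ψ))
    ∨-introʳ       : ∀ φ ψ → Axiom (ψ ⊃ (φ ∨ ψ))
    ∨-elim         : ∀ φ ψ χ → Axiom ((φ ⊃ χ) ⊃ ((ψ ⊃ χ) ⊃ ((φ ∨ ψ) ⊃ χ)))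
    contraposition : ∀ φ ψ → Axiom (((∼ φ) ⊃ (∼ ψ)) ⊃ (ψ ⊃ φ))

------------------------------------------------------------------------
-- Propositional ontology

Name : Set
Name = ℕ

data OForm : Set where
  ϵ   : Name → Name → OForm
  _∨_ : OForm → OForm → OForm
  ∼_  : OForm → OForm

module O = Classical {OForm} _∨_ ∼_

infix 2 ⊢L₁_

data ⊢L₁_ : OForm → Set where
  classical : ∀ {φ} → O.Axiom φ → ⊢L₁ φ
  ax1       : ∀ a b → ⊢L₁ (ϵ a b O.⊃ ϵ a a)
  ax2       : ∀ a b c → ⊢L₁ ((ϵ a b O.∧ ϵ b c) O.⊃ ϵ a c)
  ax3       : ∀ a b c → ⊢L₁ ((ϵ a b O.∧ ϵ b c) O.⊃ ϵ b a)
  mp        : ∀ {φ ψ} → ⊢L₁ (φ O.⊃ ψ) → ⊢L₁ φ → ⊢L₁ ψ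

------------------------------------------------------------------------
-- Modal logic

PVar : Set
PVar = ℕ

data MForm : Set where
  var : PVar → MForm
  _∨_ : MForm → MForm → MForm
  ∼_  : MForm → MForm
  □_  : MForm → MForm

module M = Classical {MForm} _∨_ ∼_

substitute : (PVar → MForm) → MForm → MForm
substitute σ (var p) = σ p
substitute σ (φ ∨ ψ) = substitute σ φ ∨ substitute σ ψ
substitute σ (∼ φ)   = ∼ substitute σ φ
substitute σ (□ φ)   = □ substitute σ φ

data K : Pred MForm 0ℓ where
  classical     : ∀ {φ} → M.Axiom φ → K φ
  □-distributes : ∀ φ ψ → K ((□ (φ M.⊃ ψ)) M.⊃ ((□ φ) M.⊃ (□ ψ)))
  mp            : ∀ {φ ψ} → K (φ M.⊃ ψ) → K φ → K ψ
  nec           : ∀ {φ} → K φ → K (□ φ)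

record IsNormalModalLogic (X : Pred MForm ℓ) : Set ℓ where
  field
    K⊆X           : K ⊆ X
    modus-ponens  : ∀ {φ ψ} → X (φ M.⊃ ψ) → X φ → X ψ
    substitution  : ∀ σ {φ} → X φ → X (substitute σ φ)
    necessitation : ∀ {φ} → X φ → X (□ φ)

------------------------------------------------------------------------
-- Kripke semantics

record Frame : Set₁ where
  field
    World : Set
    R     : Rel World 0ℓ

module Semantics (𝔽 : Frame) where
  open Frame 𝔽

  Valuation : Set₁
  Valuation = PVar → Pred World 0ℓ

  -- The usual satisfaction clauses, read in the ambient logic.  Since K
  -- contains φ ∨ ∼ φ, completeness of a normal logic with respect to a family
  -- of frames with at least one world carries excluded middle for Set with it.
  -- Statements assuming completeness are thus about classical Kripke semantics,
  -- with no separate excluded-middle hypothesis.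

  infix 4 _,_⊩_

  _,_⊩_ : Valuation → World → MForm → Set
  V , w ⊩ var p   = V p w
  V , w ⊩ (φ ∨ ψ) = (V , w ⊩ φ) ⊎ (V , w ⊩ ψ)
  V , w ⊩ (∼ φ)   = ¬ (V , w ⊩ φ)
  V , w ⊩ (□ φ)   = ∀ v → R w v → V , v ⊩ φ

  Valid : MForm → Set₁
  Valid φ = ∀ V w → V , w ⊩ φ

open Semantics public using (Valid)

Complete : Pred MForm ℓ → {I : Set ι} → (I → Frame) → Set (ℓ ⊔ ι ⊔ lsuc 0ℓ)
Complete X F = ∀ χ → X χ ⇔ (∀ α → Valid (F α) χ)

Infinite : Set → Set
Infinite A = ¬ (∃ λ n → A ↔ Fin n)

-- Frames of the shape {*, g₀, …, gᵢ} ∪ {ηⱼ : j ∈ ω}.  That η enumerates a set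
-- of cardinality ℵ₀ is rendered by taking the enumeration to be injective.

record IsStarFrame (i : ℕ) (𝔽 : Frame) : Set where
  open Frame 𝔽
  field
    *           : World
    g           : Fin (suc i) → World
    η           : ℕ → World
    g-injective : Injective _≡_ _≡_ g
    η-injective : Injective _≡_ _≡_ η
    *≢g         : ∀ j → * ≢ g j
    *≢η         : ∀ j → * ≢ η j
    g≢η         : ∀ j k → g j ≢ η k
    exhaustive  : ∀ x → x ≡ * ⊎ (∃ λ j → x ≡ g j) ⊎ (∃ λ j → x ≡ η j)
    -- g₀ is reachable from * but, the lower index bound being 1, has no
    -- successor of its own.
    R⇔          : ∀ x y → R x y ⇔
                    ( (x ≡ * × ∃ λ j → y ≡ g j)
                    ⊎ (∃₂ λ j k → 1 ≤ toℕ j × 1 ≤ toℕ k × x ≡ g j × y ≡ g k)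
                    ⊎ (∃ λ j → x ≡ η j × y ≡ η j))

------------------------------------------------------------------------
-- B-translation, relative to an assignment a ↦ pₐ of distinct propositional
-- variables to distinct name variables

B : Name ↣ PVar → OForm → MForm
B p (ϵ a b) = pᵥ a M.∧ (□ (pᵥ a M.⊃ pᵥ b)) M.∧ (pᵥ b M.⊃ (□ (pᵥ b M.⊃ pᵥ a)))
  where
  pᵥ : Name → MForm
  pᵥ c = var (Injection.to p c)
B p (φ ∨ ψ) = B p φ ∨ B p ψ
B p (∼ φ)   = ∼ B p φ

Faithful : Name ↣ PVar → Pred MForm ℓ → Set ℓ
Faithful p X = ∀ φ → X (B p φ) → ⊢L₁ φ

-- Faithfulness reduces to a countermodel construction.  If Γ does not prove φ
-- but decides the atoms of φ, let ε a b mean Γ ⊢ ϵ a b, and on a star frame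
-- whose g's include one point for every name a in φ let
--   pₐ = {* ∣ ε a a} ∪ {gⱼ ∣ ε j a}.
-- Then B(ϵ a b) holds at * exactly when ε a b: inclusion of pₐ in p_b on the
-- g's follows from ε a b by transitivity, and yields ε a b at the point indexed
-- by a.  Hence B(φ) fails at *.  It is enough to consider contexts
-- deciding the atoms of φ, because a derivation may be split on each atom.

module Submission where

open import Defs
open import Level using (Level; 0ℓ)
open import Axiom.ExcludedMiddle using (ExcludedMiddle)
open import Axiom.DoubleNegationElimination using (em⇒dne)
open import Data.Fin using (Fin; toℕ; fromℕ<)
open import Data.Fin.Properties using (toℕ-fromℕ<)
open import Data.List using (List; []; _∷_; _++_; map)
open import Data.List.Extrema.Nat using (max; xs≤max)
open import Data.List.Membership.Propositional using (_∈_)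
open import Data.List.Relation.Unary.All as All using (All; []; _∷_)
open import Data.List.Relation.Unary.All.Properties using (++⁻ˡ; ++⁻ʳ; map⁻)
open import Data.List.Relation.Unary.Any using (here; there)
open import Data.Nat using (ℕ; _≤_; s≤s)
open import Data.Product using (∃; _×_; _,_; proj₁)
open import Data.Sum using (_⊎_; inj₁; inj₂; [_,_]; swap) renaming (map to ⊎-map)
open import Function using (_∘_; const; id)
open import Function.Bundles using (_↣_; _⇔_; mk⇔; module Equivalence; module Injection)
open import Relation.Binary.Core using (Rel)
open import Relation.Binary.PropositionalEquality using (_≡_; refl; sym; subst)
open import Relation.Nullary using (¬_; yes; no; contradiction)
open import Relation.Nullary.Decidable using (toSum; fromSum)
open import Relation.Unary using (Pred)

open Equivalence using (to; from)

-- Parametric in the provability predicate because the same derived rules serve both derivations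
-- from a context and `K`.
module Calculus {Form : Set} (_∨_ : Form → Form → Form) (∼_ : Form → Form)
  (Thm : Form → Set)
  (axiom : ∀ {φ} → Classical.Axiom _∨_ ∼_ φ → Thm φ)
  (detach : ∀ {φ ψ} → Thm (Classical._⊃_ _∨_ ∼_ φ ψ) → Thm φ → Thm ψ)
  where

  open Classical _∨_ ∼_

  ⊃-const : ∀ {φ ψ} → Thm ψ → Thm (φ ⊃ ψ)
  ⊃-const = detach (axiom (weakening _ _))

  ⊃-apply : ∀ {φ ψ χ} → Thm (φ ⊃ (ψ ⊃ χ)) → Thm (φ ⊃ ψ) → Thm (φ ⊃ χ)
  ⊃-apply d e = detach (detach (axiom (distribution _ _ _)) d) e

  ⊃-refl : ∀ {φ} → Thm (φ ⊃ φ)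
  ⊃-refl {φ} = ⊃-apply (axiom (weakening φ (φ ⊃ φ))) (axiom (weakening φ φ))

  ∨-injˡ : ∀ {φ ψ} → Thm φ → Thm (φ ∨ ψ)
  ∨-injˡ = detach (axiom (∨-introˡ _ _))

  ∨-injʳ : ∀ {φ ψ} → Thm ψ → Thm (φ ∨ ψ)
  ∨-injʳ = detach (axiom (∨-introʳ _ _))

  ∨-cases : ∀ {φ ψ χ} → Thm (φ ⊃ χ) → Thm (ψ ⊃ χ) → Thm ((φ ∨ ψ) ⊃ χ)
  ∨-cases d e = detach (detach (axiom (∨-elim _ _ _)) d) e

  explosion : ∀ {φ ψ} → Thm (∼ φ) → Thm (φ ⊃ ψ)
  explosion = ∨-injˡ

  -- φ ⊃ φ is literally the instance (∼ φ) ∨ φ of excluded middle.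
  by-cases : ∀ {φ ψ} → Thm (φ ⊃ ψ) → Thm ((∼ φ) ⊃ ψ) → Thm ψ
  by-cases d e = detach (∨-cases e d) ⊃-refl

  ∼∼-intro : ∀ {φ} → Thm φ → Thm (∼ ∼ φ)
  -- The split is on `∼ φ`; `∨-introˡ` is used in the form `∼ φ ⊃ (φ ⊃ ∼ ∼ φ)`.
  ∼∼-intro d = by-cases (⊃-apply (axiom (∨-introˡ _ _)) (⊃-const d)) ⊃-refl

  ∼∨-intro : ∀ {φ ψ} → Thm (∼ φ) → Thm (∼ ψ) → Thm (∼ (φ ∨ ψ))
  ∼∨-intro d e = by-cases (∨-cases (explosion d) (explosion e)) ⊃-refl

  ∧-intro : ∀ {φ ψ} → Thm φ → Thm ψ → Thm (φ ∧ ψ)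
  ∧-intro d e = ∼∨-intro (∼∼-intro d) (∼∼-intro e)

infix 2 _⊢_

data _⊢_ (Γ : List OForm) : OForm → Set where
  thm : ∀ {φ} → ⊢L₁ φ → Γ ⊢ φ
  hyp : ∀ {φ} → φ ∈ Γ → Γ ⊢ φ
  mp  : ∀ {φ ψ} → Γ ⊢ (φ O.⊃ ψ) → Γ ⊢ φ → Γ ⊢ ψ

module ⊢-Calculus (Γ : List OForm) =
  Calculus _∨_ ∼_ (Γ ⊢_) (thm ∘ classical) mp

weaken : ∀ {Γ φ ψ} → Γ ⊢ φ → ψ ∷ Γ ⊢ φ
weaken (thm d)  = thm d
weaken (hyp φ∈) = hyp (there φ∈)
weaken (mp d e) = mp (weaken d) (weaken e)

deduction : ∀ {Γ φ ψ} → φ ∷ Γ ⊢ ψ → Γ ⊢ (φ O.⊃ ψ)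
deduction (thm d)           = ⊢-Calculus.⊃-const _ (thm d)
deduction (hyp (here refl)) = ⊢-Calculus.⊃-refl _
deduction (hyp (there ψ∈))  = ⊢-Calculus.⊃-const _ (hyp ψ∈)
deduction (mp d e)          = ⊢-Calculus.⊃-apply _ (deduction d) (deduction e)

closed⇒theorem : ∀ {φ} → [] ⊢ φ → ⊢L₁ φ
closed⇒theorem (thm d)  = d
closed⇒theorem (mp d e) = mp (closed⇒theorem d) (closed⇒theorem e)

Decides : List OForm → OForm → Set
Decides Γ φ = (Γ ⊢ φ) ⊎ (Γ ⊢ (∼ φ))

decides-weaken : ∀ {Γ φ ψ} → Decides Γ φ → Decides (ψ ∷ Γ) φ
decides-weaken = ⊎-map weaken weaken

-- Quantifying over `Γ` lets `d` be applied to both extensions of a context, by `α` and by `∼ α`;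
-- the deduction theorem and `by-cases` then discharge the added hypothesis.
by-deciding : ∀ αs {φ} → (∀ Γ → All (Decides Γ) αs → Γ ⊢ φ) → [] ⊢ φ
by-deciding []       d = d [] []
by-deciding (α ∷ αs) d = by-deciding αs λ Γ decided →
  ⊢-Calculus.by-cases Γ
    (deduction (d (α ∷ Γ) (inj₁ (hyp (here refl)) ∷ All.map decides-weaken decided)))
    (deduction (d ((∼ α) ∷ Γ) (inj₂ (hyp (here refl)) ∷ All.map decides-weaken decided)))

record IsOntology (ε : Rel Name 0ℓ) : Set where
  field
    singular  : ∀ {a b} → ε a b → ε a a
    ε-trans   : ∀ {a b c} → ε a b → ε b c → ε a c
    ε-reverse : ∀ {a b c} → ε a b → ε b c → ε b a

⊢-isOntology : ∀ Γ → IsOntology (λ a b → Γ ⊢ ϵ a b)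
⊢-isOntology Γ = record
  { singular  = mp (thm (ax1 _ _))
  ; ε-trans   = λ d e → mp (thm (ax2 _ _ _)) (∧-intro d e)
  ; ε-reverse = λ d e → mp (thm (ax3 _ _ _)) (∧-intro d e)
  }
  where open ⊢-Calculus Γ

module Connectives (em : ExcludedMiddle 0ℓ) (𝔽 : Frame) (V : Semantics.Valuation 𝔽) where
  open Semantics 𝔽

  -- As `⊃` and `∧` abbreviate formulas in `∨` and `∼`, their intended reading at a world rests on
  -- `em`.
  ⊩⊃ : ∀ w φ ψ → (V , w ⊩ (φ M.⊃ ψ)) ⇔ (V , w ⊩ φ → V , w ⊩ ψ)
  ⊩⊃ w φ ψ = mk⇔
    [ (λ ¬x x → contradiction x ¬x) , const ]
    (λ f → swap (⊎-map f id (toSum (em {V , w ⊩ φ}))))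

  ⊩∧ : ∀ w φ ψ → (V , w ⊩ (φ M.∧ ψ)) ⇔ (V , w ⊩ φ × V , w ⊩ ψ)
  ⊩∧ w φ ψ = mk⇔
    (λ h → em⇒dne em (h ∘ inj₁) , em⇒dne em (h ∘ inj₂))
    (λ (x , y) → [ (λ ¬x → ¬x x) , (λ ¬y → ¬y y) ])

module StarModel (em : ExcludedMiddle 0ℓ) (p : Name ↣ PVar)
  {i : ℕ} {𝔽 : Frame} (star : IsStarFrame i 𝔽)
  {ε : Rel Name 0ℓ} (ontology : IsOntology ε)
  where

  open Frame 𝔽
  open IsStarFrame star
  open IsOntology ontology
  open Semantics 𝔽

  pᵥ : Name → PVar
  pᵥ = Injection.to p

  -- The point `g j` stands for the name `toℕ j`. A variable `q` may lie outside the range of `p`,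
  -- hence the existential over names; injectivity of `p` makes the name unique.
  V : Valuation
  V q w = ∃ λ a → pᵥ a ≡ q × ((w ≡ * × ε a a) ⊎ ∃ λ j → w ≡ g j × ε (toℕ j) a)

  open Connectives em 𝔽 V

  V-* : ∀ {a} → V (pᵥ a) * ⇔ ε a a
  V-* {a} = mk⇔ forth λ x → a , refl , inj₁ (refl , x)
    where
    forth : V (pᵥ a) * → ε a a
    forth (b , pb≡pa , x) with Injection.injective p pb≡pa | x
    ... | refl | inj₁ (_ , y)        = y
    ... | refl | inj₂ (j , *≡gj , _) = contradiction *≡gj (*≢g j)

  V-g : ∀ {a} j → V (pᵥ a) (g j) ⇔ ε (toℕ j) a
  V-g {a} j = mk⇔ forth λ x → a , refl , inj₂ (j , refl , x)
    where
    forth : V (pᵥ a) (g j) → ε (toℕ j) a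
    forth (b , pb≡pa , x) with Injection.injective p pb≡pa | x
    ... | refl | inj₁ (gj≡* , _)     = contradiction (sym gj≡*) (*≢g j)
    ... | refl | inj₂ (k , gj≡gk , y) with g-injective gj≡gk
    ...   | refl = y

  -- Boxes in the translation of an atom are not nested, so each is evaluated at `*`. From there
  -- `g₀` is reachable too, so the name 0 is represented.
  R*⇔ : ∀ {v} → R * v ⇔ (∃ λ j → v ≡ g j)
  R*⇔ {v} = mk⇔ (forth ∘ to (R⇔ * v)) λ x → from (R⇔ * v) (inj₁ (refl , x))
    where
    forth : _ → ∃ λ j → v ≡ g j
    forth (inj₁ (_ , x))                        = x
    forth (inj₂ (inj₁ (j , _ , _ , _ , *≡gj , _))) = contradiction *≡gj (*≢g j)
    forth (inj₂ (inj₂ (j , *≡ηj , _)))             = contradiction *≡ηj (*≢η j)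

  ⊩□⊃ : ∀ a b →
    (V , * ⊩ (□ (var (pᵥ a) M.⊃ var (pᵥ b)))) ⇔
    (∀ (j : Fin _) → ε (toℕ j) a → ε (toℕ j) b)
  ⊩□⊃ a b = mk⇔
    (λ h j → to (V-g j) ∘ to (⊩⊃ (g j) pa pb) (h (g j) (from R*⇔ (j , refl))) ∘ from (V-g j))
    back
    where
    pa pb : MForm
    pa = var (pᵥ a)
    pb = var (pᵥ b)
    back : (∀ j → ε (toℕ j) a → ε (toℕ j) b) → V , * ⊩ (□ (pa M.⊃ pb))
    back f v R*v with to R*⇔ R*v
    ... | j , refl = from (⊩⊃ v pa pb) (from (V-g j) ∘ f j ∘ to (V-g j))

  ⊩B-ϵ : ∀ {a b} → a ≤ i → (V , * ⊩ B p (ϵ a b)) ⇔ ε a b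
  ⊩B-ϵ {a} {b} a≤i = mk⇔ forth back
    where
    pa pb incl conv : MForm
    pa   = var (pᵥ a)
    pb   = var (pᵥ b)
    incl = □ (pa M.⊃ pb)
    conv = pb M.⊃ (□ (pb M.⊃ pa))

    forth : V , * ⊩ B p (ϵ a b) → ε a b
    forth h = let x , rest = to (⊩∧ * pa (incl M.∧ conv)) h
                  y , _    = to (⊩∧ * incl conv) rest
              -- The inclusion is tested at the point standing for `a` itself, which exists as
              -- `a ≤ i`: there it turns `ε a a` into `ε a b`.
              in subst (λ c → ε c a → ε c b) (toℕ-fromℕ< (s≤s a≤i))
                   (to (⊩□⊃ a b) y (fromℕ< (s≤s a≤i))) (to V-* x)

    back : ε a b → V , * ⊩ B p (ϵ a b)
    back x = from (⊩∧ * pa (incl M.∧ conv))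
      ( from V-* (singular x)
      , from (⊩∧ * incl conv)
          ( from (⊩□⊃ a b) (λ _ y → ε-trans y x)
          -- Truth of `pb` at `*` means `ε b b`, so reversal of `ε a b` gives `ε b a`, and
          -- transitivity the converse inclusion.
          , from (⊩⊃ * pb (□ (pb M.⊃ pa))) λ y → from (⊩□⊃ b a) λ _ z →
              ε-trans z (ε-reverse x (to V-* y))))

atoms : OForm → List (Name × Name)
atoms (ϵ a b) = (a , b) ∷ []
atoms (φ ∨ ψ) = atoms φ ++ atoms ψ
atoms (∼ φ)   = atoms φ

module Countermodel (em : ExcludedMiddle 0ℓ) (p : Name ↣ PVar)
  {i : ℕ} {𝔽 : Frame} (star : IsStarFrame i 𝔽)
  {Γ : List OForm} {φ : OForm} (unprovable : ¬ (Γ ⊢ φ))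
  where

  open IsStarFrame star using (*)
  open Semantics 𝔽
  open StarModel em p star (⊢-isOntology Γ)
  open ⊢-Calculus Γ

  -- An inconsistent context would prove `φ`.
  consistent : ∀ {ψ} → Γ ⊢ (∼ ψ) → ¬ (Γ ⊢ ψ)
  consistent d e = unprovable (mp (explosion d) e)

  -- Kalmár's induction: decisions on atoms propagate to compound formulas, in step with truth at
  -- `*`. Consistency enters only at refuted atoms.
  truth : ∀ ψ → All (λ (a , b) → a ≤ i × Decides Γ (ϵ a b)) (atoms ψ) →
          (V , * ⊩ B p ψ × (Γ ⊢ ψ)) ⊎ (¬ (V , * ⊩ B p ψ) × (Γ ⊢ (∼ ψ)))
  truth (ϵ a b) ((a≤i , inj₁ d) ∷ []) = inj₁ (from (⊩B-ϵ a≤i) d , d)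
  truth (ϵ a b) ((a≤i , inj₂ d) ∷ []) = inj₂ (consistent d ∘ to (⊩B-ϵ a≤i) , d)
  truth (ψ ∨ χ) cov with truth ψ (++⁻ˡ (atoms ψ) cov) | truth χ (++⁻ʳ (atoms ψ) cov)
  ... | inj₁ (x , d) | _            = inj₁ (inj₁ x , ∨-injˡ d)
  ... | inj₂ _       | inj₁ (y , e) = inj₁ (inj₂ y , ∨-injʳ e)
  ... | inj₂ (x , d) | inj₂ (y , e) = inj₂ ([ x , y ] , ∼∨-intro d e)
  truth (∼ ψ) cov with truth ψ cov
  ... | inj₁ (x , d) = inj₂ ((λ ¬x → ¬x x) , ∼∼-intro d)
  ... | inj₂ (x , d) = inj₁ (x , d)

valid-on-stars⇒⊢ : ExcludedMiddle 0ℓ → (p : Name ↣ PVar) →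
  (H : ℕ → Frame) → (∀ i → IsStarFrame i (H i)) →
  ∀ φ → (∀ i → Valid (H i) (B p φ)) → ⊢L₁ φ
valid-on-stars⇒⊢ em p H star φ valid =
  closed⇒theorem (by-deciding (map (λ (a , b) → ϵ a b) (atoms φ)) prove)
  where
  names : List Name
  -- The test point in `⊩B-ϵ` belongs to the left name of an atom, so the left names determine which
  -- star frame is large enough.
  names = map proj₁ (atoms φ)

  n : ℕ
  n = max 0 names

  prove : ∀ Γ → All (Decides Γ) (map (λ (a , b) → ϵ a b) (atoms φ)) → Γ ⊢ φ
  prove Γ decided with em {Γ ⊢ φ}
  ... | yes d = d
  ... | no unprovable
    with Countermodel.truth em p (star n) unprovable φ
           (All.zip (map⁻ (xs≤max 0 names) , map⁻ decided))
  ...   | inj₁ (_ , d)  = d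
  ...   | inj₂ (¬x , _) = contradiction (valid n _ _) ¬x

-- `var 0 M.⊃ var 0` unfolds to `∼ var 0 ∨ var 0`; under the valuation that is constantly `P`, its
-- truth at `w` is `¬ P ⊎ P`.
complete⇒em : ∀ {ℓ ι} {X : Pred MForm ℓ} → IsNormalModalLogic X →
  {I : Set ι} {F : I → Frame} → Complete X F →
  (α : I) → Frame.World (F α) → ExcludedMiddle 0ℓ
complete⇒em normal complete α w {P} = fromSum (swap (valid (λ _ _ → P) w))
  where
  open Calculus _∨_ ∼_ K classical mp
  valid = to (complete (var 0 M.⊃ var 0))
             (IsNormalModalLogic.K⊆X normal ⊃-refl) α

theorem7p3 : ∀ {ℓ ι : Level}
    (p : Name ↣ PVar)
    (X : Pred MForm ℓ) → IsNormalModalLogic X →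
    (I : Set ι) → ℕ ↣ I →
    (F : I → Frame) →
    (∀ α → Frame.World (F α) × Infinite (Frame.World (F α))) →
    Complete X F →
    (H : ℕ → Frame) → (∀ i → IsStarFrame i (H i)) →
    (∀ i → ∃ λ α → H i ≡ F α) →
    Faithful p X
theorem7p3 p X normal I ω↣I F inhabited complete H star H⊆F φ XBφ =
  valid-on-stars⇒⊢ em p H star φ λ i →
    let α , Hi≡Fα = H⊆F i
    in subst (λ 𝔽 → Valid 𝔽 (B p φ)) (sym Hi≡Fα) (to (complete (B p φ)) XBφ α)
  where
  em : ExcludedMiddle 0ℓ
  em = let α = Injection.to ω↣I 0 in complete⇒em normal complete α (proj₁ (inhabited α))
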